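{- For every integer $K \ge 2$ one has $N_2(K) \leq 2K(K+1)+1$; that is, for every $K\ge 2$ there exists a nontrivial $K$-multimagic square of order $2K(K+1)+1$.
   Context: An $N\times N$ integer matrix is a magic square of order $N$ if the sums of the entries in each of its $N$ rows, each of its $N$ columns, and each of its two main diagonals (the entries $z_{i,i}$ and the entries $z_{i,N+1-i}$) are all equal. For $K \ge 2$, a matrix ${\mathbf Z}=(z_{i,j})\in\mathbb{Z}^{N\times N}$ is a $K$-multimagic square of order $N$ (an MMS$(K,N)$) if for every $1\le k\le K$ the matrix $(z_{i,j}^k)_{1\le i,j\le N}$ is a magic square. An MMS$(K,N)$ is called trivial if its entries take $N$ or fewer distinct integer values, and nontrivial otherwise. $N_2(K)$ denotes the smallest positive integer $N$ for which there exists a nontrivial MMS$(K,N)$. -}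

module Defs where

open import Data.Nat using (ℕ; zero; suc; _+_; _*_; _≤_)
open import Data.Integer using (ℤ; 0ℤ) renaming (_+_ to _+ℤ_; _^_ to _^ℤ_)
open import Data.Fin using (Fin; opposite) renaming (zero to fz; suc to fs)
open import Data.Product using (_×_; Σ; _,_; proj₁; proj₂)
open import Relation.Binary.PropositionalEquality using (_≡_)
open import Relation.Nullary using (¬_)

Matrix : ℕ → Set
Matrix N = Fin N → Fin N → ℤ

sumFin : ∀ {n} → (Fin n → ℤ) → ℤ
sumFin {zero}  f = 0ℤ
sumFin {suc n} f = f fz +ℤ sumFin (λ i → f (fs i))

-- Magic square: all N row sums, N column sums and the two main diagonal
-- sums are equal (to a common value s).
-- The anti-diagonal z_{i,N+1-i} (1-based) is z i (opposite i) (0-based).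
IsMagic : (N : ℕ) → Matrix N → Set
IsMagic N z = Σ ℤ λ s →
    (∀ i → sumFin (λ j → z i j) ≡ s)
  × (∀ j → sumFin (λ i → z i j) ≡ s)
  × (sumFin (λ i → z i i) ≡ s)
  × (sumFin (λ i → z i (opposite i)) ≡ s)

powMatrix : ∀ {N} → ℕ → Matrix N → Matrix N
powMatrix k z i j = z i j ^ℤ k

IsMultimagic : (K N : ℕ) → Matrix N → Set
IsMultimagic K N z = ∀ k → 1 ≤ k → k ≤ K → IsMagic N (powMatrix k z)

-- Nontrivial: the entries take more than N distinct values, i.e. there are
-- N+1 positions whose entries are pairwise distinct.
Nontrivial : (N : ℕ) → Matrix N → Set
Nontrivial N z = Σ (Fin (suc N) → Fin N × Fin N) λ p →
  ∀ a b → ¬ a ≡ b → ¬ z (proj₁ (p a)) (proj₂ (p a)) ≡ z (proj₁ (p b)) (proj₂ (p b))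

{-# OPTIONS --safe #-}
module Submission where

-- Fill an order N square with n = t + 3 fillers and t = K (K + 1) - 1 colours so
-- that all rows, columns and both diagonals contain each symbol once, the
-- colours form a t × t subsquare, and outside of it the diagonals meet only
-- fillers.  Replace the colours inside the subsquare by a tuple b and outside
-- of it by a tuple a with the same power sums up to degree K: every line keeps
-- its power sums, and one entry of b joins the N distinct values that were there.
-- The pair a, b comes from the pigeonhole principle, as t > K (K + 1) / 2.
-- With n = 2 h, rows and columns outside the subsquare are residues x, y
-- modulo n, and the cell has a filler precisely when y - x is 0, 1 or h; the
-- diagonals are y - x = 0 and y - x = h.  Inside the subsquare the cell p, q has
-- colour 2 p + q modulo t, which is Latin on all lines as t is coprime to 6.

open import Defs
import Algebra.Properties.CommutativeMonoid.Sum as CommutativeMonoidSum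
open import Data.Fin using
  (Fin; zero; suc; toℕ; fromℕ<; combine; finToFun; funToFin; opposite; punchIn; punchOut;
   splitAt; join; _↑ˡ_; _↑ʳ_)
open import Data.Fin.Patterns using (0F; 1F; 2F)
open import Data.Fin.Properties using
  (pigeonhole; toℕ<n; toℕ-injective; toℕ-fromℕ<; fromℕ<-injective; combine-injective;
   funToFin-finToFin; ¬∀⟶∃¬; toℕ-↑ˡ; toℕ-↑ʳ; splitAt-join; splitAt-↑ˡ; splitAt-↑ʳ;
   splitAt⁻¹-↑ˡ; splitAt⁻¹-↑ʳ; opposite-prop; opposite-involutive;
   punchInᵢ≢i; punchIn-injective; punchIn-punchOut; punchOut-injective)
  renaming (_≟_ to _≟F_; <⇒≢ to <⇒≢F; suc-injective to sucF-injective)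
open import Data.Integer using (ℤ; +_; ∣_∣)
  renaming (_+_ to _+ℤ_; _*_ to _*ℤ_; _-_ to _-ℤ_; -_ to -ℤ_; _^_ to _^ℤ_)
open import Data.Integer.DivMod using (_%ℕ_; _/ℕ_; n%ℕd<d; a≡a%ℕn+[a/ℕn]*n)
open import Data.Integer.Divisibility.Signed
  using (divides; ∣⇒∣ᵤ; ∣m∣n⇒∣m+n; ∣m∣n⇒∣m-n; ∣n⇒∣m*n; ∣m⇒∣m*n; ∣-refl)
  renaming (_∣_ to _∣ℤ_)
import Data.Integer.Properties as ℤ
open import Data.Integer.Tactic.RingSolver using () renaming (solve-∀ to solve-∀ℤ)
open import Data.Nat using (ℕ; zero; suc; _+_; _*_; _^_; _≤_; _<_; NonZero; s≤s)
import Data.Nat.Divisibility as ℕ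
import Data.Nat.Properties as ℕ
open import Data.Nat.Tactic.RingSolver using () renaming (solve-∀ to solve-∀ℕ)
open import Data.Product using (Σ; ∃; _×_; _,_; proj₁; proj₂)
open import Data.Sum as Sum using (_⊎_; inj₁; inj₂)
open import Data.Sum.Properties using (inj₁-injective; inj₂-injective)
open import Function using (_∘_)
open import Relation.Binary.PropositionalEquality
open import Relation.Nullary using (¬_; yes; no; contradiction)

open CommutativeMonoidSum ℕ.+-0-commutativeMonoid using () renaming (sum to sumℕ)

-- Tuples with equal power sums.

tri : ℕ → ℕ
tri zero    = 0
tri (suc k) = tri k + suc k

sumℕ-< : ∀ {n b} .{{_ : NonZero n}} (f : Fin n → ℕ) → (∀ i → f i < b) → sumℕ f < n * b
sumℕ-< {suc zero}    {b} f f<b = ℕ.+-monoˡ-< 0 (f<b zero)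
sumℕ-< {suc (suc n)} {b} f f<b = ℕ.+-mono-< (f<b zero) (sumℕ-< (f ∘ suc) (f<b ∘ suc))

prodBelow : (ℕ → ℕ) → ℕ → ℕ
prodBelow B zero    = 1
prodBelow B (suc k) = B k * prodBelow B k

-- Mixed radix notation with bases `B j`: a vector of power sums becomes a single element of a
-- `Fin`, the form that the pigeonhole principle takes.
encode : ∀ B k → (∀ j → Fin (B j)) → Fin (prodBelow B k)
encode B zero    f = zero
encode B (suc k) f = combine (f k) (encode B k f)

encode-injective : ∀ B k (f g : ∀ j → Fin (B j)) → encode B k f ≡ encode B k g →
                   ∀ j → j < k → f j ≡ g j
encode-injective B (suc k) f g eq j j<1+k with combine-injective (f k) _ (g k) _ eq | j ℕ.≟ k
... | fk≡gk , _  | yes refl = fk≡gk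
... | _     , eq′ | no j≢k  = encode-injective B k f g eq′ j (ℕ.≤∧≢⇒< (ℕ.≤-pred j<1+k) j≢k)

module _ {t X : ℕ} where

  -- `combine i r` has the value `i X + r`, so the number alone recovers the block and the offset in
  -- it.
  inBlocks : (Fin t → Fin X) → Fin t → ℕ
  inBlocks x i = toℕ (combine i (x i))

  inBlocks-< : ∀ x i → inBlocks x i < t * X
  inBlocks-< x i = toℕ<n (combine i (x i))

  inBlocks-injective : ∀ x y {i j} → inBlocks x i ≡ inBlocks y j → i ≡ j × x i ≡ y j
  inBlocks-injective x y {i} {j} eq = combine-injective i (x i) j (y j) (toℕ-injective eq)

-- Index `k` belongs to exponent `k + 1`: there are `t` terms, each below `(t X) ^ (k + 1)`.
powerSumBound : ℕ → ℕ → ℕ → ℕ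
powerSumBound t X k = t * (t * X) ^ suc k

boundConst : ℕ → ℕ → ℕ
boundConst t zero    = 1
boundConst t (suc k) = t * t ^ suc k * boundConst t k

-- The factor of index `j` contributes `X ^ (j + 1)`, and `1 + ... + k` is `tri k`; everything free
-- of `X` collects in `boundConst`.
prodBelow-powerSumBound : ∀ t X k →
  prodBelow (powerSumBound t X) k ≡ boundConst t k * X ^ tri k
prodBelow-powerSumBound t X zero    = refl
prodBelow-powerSumBound t X (suc k) = begin
  t * (t * X) ^ suc k * prodBelow (powerSumBound t X) k
    ≡⟨ cong₂ (λ u v → t * u * v) (*-^ t X (suc k)) (prodBelow-powerSumBound t X k) ⟩
  t * (t ^ suc k * X ^ suc k) * (boundConst t k * X ^ tri k)
    ≡⟨ lemma t (t ^ suc k) (X ^ suc k) (boundConst t k) (X ^ tri k) ⟩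
  t * t ^ suc k * boundConst t k * (X ^ tri k * X ^ suc k)
    ≡⟨ cong (t * t ^ suc k * boundConst t k *_) (ℕ.^-distribˡ-+-* X (tri k) (suc k)) ⟨
  t * t ^ suc k * boundConst t k * X ^ (tri k + suc k) ∎
  where
  open ≡-Reasoning
  *-^ : ∀ a b m → (a * b) ^ m ≡ a ^ m * b ^ m
  *-^ a b zero    = refl
  *-^ a b (suc m) = trans (cong (a * b *_) (*-^ a b m)) (swap a b (a ^ m) (b ^ m))
    where
    swap : ∀ p q r s → p * q * (r * s) ≡ p * r * (q * s)
    swap = solve-∀ℕ
  lemma : ∀ p q r s u → p * (q * r) * (s * u) ≡ p * q * s * (u * r)
  lemma = solve-∀ℕ

-- `M` is recorded so that the fillers can be placed above all colours; the last component is the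
-- entry of `b` that becomes the extra value.
EqualPowerSums : ℕ → ℕ → Set
EqualPowerSums K t = Σ ℕ λ M → Σ (Fin t → ℕ) λ a → Σ (Fin t → ℕ) λ b →
    (∀ i → a i < M) × (∀ i → b i < M)
  × (∀ i j → a i ≡ a j → i ≡ j)
  × (∀ k → 1 ≤ k → k ≤ K → sumℕ (λ i → a i ^ k) ≡ sumℕ (λ i → b i ^ k))
  × (Σ (Fin t) λ c → ∀ i → a i ≢ b c)

-- Pigeonhole for the Prouhet–Tarry–Escott problem: there are X ^ t tuples with
-- one entry in each interval [ i X , (i + 1) X ), but only O(X ^ (K (K + 1) / 2))
-- vectors of power sums.  Confining entries to separate intervals makes each
-- tuple injective and lets the tuples coincide only position by position.
equalPowerSums : ∀ K t .{{_ : NonZero t}} → tri K < t → EqualPowerSums K t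
equalPowerSums K t tri<t with pigeonhole few (encode (powerSumBound t X) K ∘ powerSums ∘ finToFun)
  module Counting where
  -- One more than the constant, so that the number of vectors falls below `X ^ (tri K + 1)`, which
  -- is at most `X ^ t`.
  X = suc (boundConst t K)

  powerSums : (Fin t → Fin X) → ∀ k → Fin (powerSumBound t X k)
  powerSums x k = fromℕ< (sumℕ-< (λ i → inBlocks x i ^ suc k)
                                 (λ i → ℕ.^-monoˡ-< (suc k) (inBlocks-< x i)))

  few : prodBelow (powerSumBound t X) K < X ^ t
  few = begin-strict
    prodBelow (powerSumBound t X) K ≡⟨ prodBelow-powerSumBound t X K ⟩
    boundConst t K * X ^ tri K      <⟨ ℕ.*-monoˡ-< (X ^ tri K) {{ℕ.m^n≢0 X (tri K)}} (ℕ.n<1+n (boundConst t K)) ⟩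
    X * X ^ tri K                   ≡⟨⟩
    X ^ suc (tri K)                 ≤⟨ ℕ.^-monoʳ-≤ X tri<t ⟩
    X ^ t                           ∎
    where open ℕ.≤-Reasoning
... | m , n , m<n , same =
  t * X , inBlocks x , inBlocks y , inBlocks-< x , inBlocks-< y ,
  (λ i j → proj₁ ∘ inBlocks-injective x x) ,
  equal , proj₁ differ , new
  where
  open Counting K t tri<t
  x y : Fin t → Fin X
  x = finToFun m
  y = finToFun n

  equal : ∀ k → 1 ≤ k → k ≤ K → sumℕ (λ i → inBlocks x i ^ k) ≡ sumℕ (λ i → inBlocks y i ^ k)
  equal (suc k) _ k<K = fromℕ<-injective _ _ _ _
    (encode-injective (powerSumBound t X) K (powerSums x) (powerSums y) same k k<K)

  funToFin-cong : ∀ {p q} {f g : Fin p → Fin q} → (∀ i → f i ≡ g i) → funToFin f ≡ funToFin g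
  funToFin-cong {zero}  f≗g = refl
  funToFin-cong {suc p} f≗g = cong₂ combine (f≗g zero) (funToFin-cong (f≗g ∘ suc))

  differ : ∃ λ i → x i ≢ y i
  differ = ¬∀⟶∃¬ t (λ i → x i ≡ y i) (λ i → x i ≟F y i) λ x≗y →
    <⇒≢F m<n (trans (sym (funToFin-finToFin {t} m)) (trans (funToFin-cong x≗y) (funToFin-finToFin {t} n)))

  new : ∀ i → inBlocks x i ≢ inBlocks y (proj₁ differ)
  new i eq with inBlocks-injective x y eq
  ... | refl , xi≡yi = proj₂ differ xi≡yi

-- Residues modulo `n`.

module Residues (n : ℕ) .{{_ : NonZero n}} where

  ⟦_⟧ : Fin n → ℤ
  ⟦ x ⟧ = + toℕ x

  infix 4 _≋_
  -- With congruence stated over ℤ, each cancellation law below is one linear identity between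
  -- integers; of `red` only `red-≋` is ever used.
  _≋_ : ℤ → ℤ → Set
  a ≋ b = + n ∣ℤ a -ℤ b

  abstract
    red : ℤ → Fin n
    red a = fromℕ< (n%ℕd<d a n)

    red-≋ : ∀ a → ⟦ red a ⟧ ≋ a
    red-≋ a = divides (-ℤ (a /ℕ n)) (begin
      ⟦ red a ⟧ -ℤ a
        ≡⟨ cong₂ (λ r b → + r -ℤ b) (toℕ-fromℕ< (n%ℕd<d a n)) (a≡a%ℕn+[a/ℕn]*n a n) ⟩
      + (a %ℕ n) -ℤ (+ (a %ℕ n) +ℤ (a /ℕ n) *ℤ + n)
        ≡⟨ lemma (+ (a %ℕ n)) (a /ℕ n) (+ n) ⟩
      -ℤ (a /ℕ n) *ℤ + n ∎)
      where
      open ≡-Reasoning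
      lemma : ∀ r q m → r -ℤ (r +ℤ q *ℤ m) ≡ -ℤ q *ℤ m
      lemma = solve-∀ℤ

  -- Two representatives differ by less than `n`, and the only multiple of `n` that small is 0.
  ≋⇒≡ : ∀ {x y} → ⟦ x ⟧ ≋ ⟦ y ⟧ → x ≡ y
  ≋⇒≡ {x} {y} x≋y = toℕ-injective (ℤ.+-injective (ℤ.i-j≡0⇒i≡j ⟦ x ⟧ ⟦ y ⟧
    (ℤ.∣i∣≡0⇒i≡0 (small (∣⇒∣ᵤ x≋y) distance<n))))
    where
    small : ∀ {d} → n ℕ.∣ d → d < n → d ≡ 0
    small {zero}  _   _   = refl
    small {suc d} n∣d d<n = contradiction n∣d (ℕ.>⇒∤ d<n)
    distance<n : ∣ ⟦ x ⟧ -ℤ ⟦ y ⟧ ∣ < n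
    distance<n = ℕ.≤-<-trans
      (ℕ.≤-trans (ℕ.≤-reflexive (cong ∣_∣ (ℤ.m-n≡m⊖n (toℕ x) (toℕ y)))) (ℤ.∣m⊝n∣≤m⊔n (toℕ x) (toℕ y)))
      (ℕ.⊔-lub (toℕ<n x) (toℕ<n y))

  red-cong : ∀ {a b} → a ≋ b → red a ≡ red b
  red-cong {a} {b} a≋b = ≋⇒≡ (subst (+ n ∣ℤ_) (lemma ⟦ red a ⟧ ⟦ red b ⟧ a b)
    (∣m∣n⇒∣m-n (∣m∣n⇒∣m+n (red-≋ a) a≋b) (red-≋ b)))
    where
    lemma : ∀ p q a b → ((p -ℤ a) +ℤ (a -ℤ b)) -ℤ (q -ℤ b) ≡ p -ℤ q
    lemma = solve-∀ℤ

  red-injective : ∀ {a b} → red a ≡ red b → a ≋ b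
  red-injective {a} {b} eq = subst (+ n ∣ℤ_) (lemma ⟦ red a ⟧ a b)
    (∣m∣n⇒∣m-n (subst (λ z → ⟦ z ⟧ ≋ b) (sym eq) (red-≋ b)) (red-≋ a))
    where
    lemma : ∀ p a b → (p -ℤ b) -ℤ (p -ℤ a) ≡ a -ℤ b
    lemma = solve-∀ℤ

  red-⟦⟧ : ∀ x → red ⟦ x ⟧ ≡ x
  red-⟦⟧ x = ≋⇒≡ (red-≋ ⟦ x ⟧)

  infixl 6 _⊕_ _⊝_
  _⊕_ _⊝_ : Fin n → Fin n → Fin n
  x ⊕ y = red (⟦ x ⟧ +ℤ ⟦ y ⟧)
  x ⊝ y = red (⟦ x ⟧ -ℤ ⟦ y ⟧)

  ⊕-cancelˡ : ∀ x {y z} → x ⊕ y ≡ x ⊕ z → y ≡ z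
  ⊕-cancelˡ x {y} {z} eq = ≋⇒≡ (subst (+ n ∣ℤ_) (lemma ⟦ x ⟧ ⟦ y ⟧ ⟦ z ⟧) (red-injective eq))
    where
    lemma : ∀ x y z → (x +ℤ y) -ℤ (x +ℤ z) ≡ y -ℤ z
    lemma = solve-∀ℤ

  ⊕-cancelʳ : ∀ x {y z} → y ⊕ x ≡ z ⊕ x → y ≡ z
  ⊕-cancelʳ x {y} {z} eq = ≋⇒≡ (subst (+ n ∣ℤ_) (lemma ⟦ x ⟧ ⟦ y ⟧ ⟦ z ⟧) (red-injective eq))
    where
    lemma : ∀ x y z → (y +ℤ x) -ℤ (z +ℤ x) ≡ y -ℤ z
    lemma = solve-∀ℤ

  ⊝-cancelʳ : ∀ x {y z} → y ⊝ x ≡ z ⊝ x → y ≡ z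
  ⊝-cancelʳ x {y} {z} eq = ≋⇒≡ (subst (+ n ∣ℤ_) (lemma ⟦ x ⟧ ⟦ y ⟧ ⟦ z ⟧) (red-injective eq))
    where
    lemma : ∀ x y z → (y -ℤ x) -ℤ (z -ℤ x) ≡ y -ℤ z
    lemma = solve-∀ℤ

  ⊝-cancelˡ : ∀ x {y z} → x ⊝ y ≡ x ⊝ z → y ≡ z
  ⊝-cancelˡ x {y} {z} eq = sym (≋⇒≡ (subst (+ n ∣ℤ_) (lemma ⟦ x ⟧ ⟦ y ⟧ ⟦ z ⟧) (red-injective eq)))
    where
    lemma : ∀ x y z → (x -ℤ y) -ℤ (x -ℤ z) ≡ z -ℤ y
    lemma = solve-∀ℤ

  -- Change of viewpoint for the cell `x, y` with difference `d`: offset `f` from the row label is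
  -- offset `f - d` from the column label.
  ⊕-shift : ∀ x y {d f e} → y ⊝ x ≡ d → ⟦ f ⟧ -ℤ ⟦ d ⟧ ≋ ⟦ e ⟧ → x ⊕ f ≡ y ⊕ e
  ⊕-shift x y {d} {f} {e} refl f-d≋e = red-cong (subst (+ n ∣ℤ_) (lemma ⟦ x ⟧ ⟦ y ⟧ ⟦ d ⟧ ⟦ f ⟧ ⟦ e ⟧)
    (∣m∣n⇒∣m+n f-d≋e (red-≋ (⟦ y ⟧ -ℤ ⟦ x ⟧))))
    where
    lemma : ∀ x y d f e → ((f -ℤ d) -ℤ e) +ℤ (d -ℤ (y -ℤ x)) ≡ (x +ℤ f) -ℤ (y +ℤ e)
    lemma = solve-∀ℤ

  ⊝-≡ : ∀ x y d → ⟦ y ⟧ -ℤ ⟦ x ⟧ ≋ ⟦ d ⟧ → y ⊝ x ≡ d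
  ⊝-≡ x y d eq = trans (red-cong eq) (red-⟦⟧ d)

toℕ-punchIn-≤ : ∀ {m} (i : Fin (suc m)) (j : Fin m) → toℕ i ≤ toℕ j → toℕ (punchIn i j) ≡ suc (toℕ j)
toℕ-punchIn-≤ zero    j       _         = refl
toℕ-punchIn-≤ (suc i) (suc j) (s≤s i≤j) = cong suc (toℕ-punchIn-≤ i j i≤j)

opposite-+ : ∀ {m} (i : Fin m) → toℕ (opposite i) + suc (toℕ i) ≡ m
opposite-+ {m} i = trans (cong (_+ suc (toℕ i)) (opposite-prop i)) (ℕ.m∸n+n≡m (toℕ<n i))

-- The Latin square and its subsquare of colours.

module Square (g : ℕ) (α β : ℤ) (bézout : + 3 *ℤ α +ℤ + suc (g + g) *ℤ β ≡ + 1) where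

  -- Here `n = 2 g + 4 = 2 h`, and `N` is written as its three blocks in order, the subsquare in the
  -- middle. `bézout` makes 3 invertible modulo `t`.
  h t n N : ℕ
  h = 2 + g
  t = suc (g + g)
  n = 3 + t
  N = h + (t + h)

  -- Fillers on the left, colours on the right.  The same type indexes rows and columns.
  Symbol : Set
  Symbol = Fin n ⊎ Fin t

  open Residues n
  module T = Residues t

  g<1+t : g < suc t
  g<1+t = ℕ.m≤n⇒m≤1+n (s≤s (ℕ.m≤m+n g g))

  -- Stands for `h` once 0 and 1 are stripped off, so that `punchIn g′` enumerates the `t` residues
  -- other than 0, 1 and `h`.
  g′ : Fin (suc t)
  g′ = fromℕ< g<1+t

  h′ : Fin n
  h′ = suc (suc g′)

  toℕ-h′ : toℕ h′ ≡ h
  toℕ-h′ = cong (λ k → suc (suc k)) (toℕ-fromℕ< g<1+t)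

  g″ : Fin (2 + t)
  g″ = fromℕ< (ℕ.m≤n⇒m≤1+n g<1+t)

  1+g″ : Fin (1 + t)
  1+g″ = fromℕ< {suc g} (s≤s (s≤s (ℕ.m≤m+n g g)))

  toℕ-1+g″ : toℕ 1+g″ ≡ suc g
  toℕ-1+g″ = toℕ-fromℕ< {suc g} (s≤s (s≤s (ℕ.m≤m+n g g)))

  toℕ-g″ : toℕ g″ ≡ g
  toℕ-g″ = toℕ-fromℕ< (ℕ.m≤n⇒m≤1+n g<1+t)

  Slot : Set
  Slot = Fin 3 ⊎ Fin t

  -- The differences 0, 1, h carry fillers, the others carry colours.
  difference : Slot → Fin n
  difference (inj₁ 0F) = 0F
  difference (inj₁ 1F) = 1F
  difference (inj₁ 2F) = h′
  difference (inj₂ k)  = suc (suc (punchIn g′ k))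

  slot : Fin n → Slot
  slot zero          = inj₁ 0F
  slot (suc zero)    = inj₁ 1F
  slot (suc (suc c)) with g′ ≟F c
  ... | yes _    = inj₁ 2F
  ... | no  g′≢c = inj₂ (punchOut g′≢c)

  difference-slot : ∀ c → difference (slot c) ≡ c
  difference-slot zero          = refl
  difference-slot (suc zero)    = refl
  difference-slot (suc (suc c)) with g′ ≟F c
  ... | yes refl = refl
  ... | no  g′≢c = cong (λ d → suc (suc d)) (punchIn-punchOut g′≢c)

  slot-injective : ∀ {c d} → slot c ≡ slot d → c ≡ d
  slot-injective {c} {d} eq =
    trans (sym (difference-slot c)) (trans (cong difference eq) (difference-slot d))

  slot-h′ : slot h′ ≡ inj₁ 2F
  slot-h′ with g′ ≟F g′
  ... | yes _    = refl
  ... | no  g≢g = contradiction refl g≢g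

  -- Equal to `difference` except that 1 and `h` are exchanged. The exchange makes the three values
  -- of `rowShift - difference` distinct, so that the fillers do not repeat in columns either.
  rowShift : Slot → Fin n
  rowShift (inj₁ 0F) = 0F
  rowShift (inj₁ 1F) = h′
  rowShift (inj₁ 2F) = 1F
  rowShift (inj₂ k)  = suc (suc (punchIn g′ k))

  rowShift-injective : ∀ r s → rowShift r ≡ rowShift s → r ≡ s
  rowShift-injective (inj₁ 0F) (inj₁ 0F) eq = refl
  rowShift-injective (inj₁ 1F) (inj₁ 1F) eq = refl
  rowShift-injective (inj₁ 2F) (inj₁ 2F) eq = refl
  rowShift-injective (inj₁ 0F) (inj₁ 1F) ()
  rowShift-injective (inj₁ 0F) (inj₁ 2F) ()
  rowShift-injective (inj₁ 1F) (inj₁ 0F) ()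
  rowShift-injective (inj₁ 1F) (inj₁ 2F) ()
  rowShift-injective (inj₁ 2F) (inj₁ 0F) ()
  rowShift-injective (inj₁ 2F) (inj₁ 1F) ()
  rowShift-injective (inj₁ 0F) (inj₂ k)  ()
  rowShift-injective (inj₁ 2F) (inj₂ k)  ()
  rowShift-injective (inj₂ k)  (inj₁ 0F) ()
  rowShift-injective (inj₂ k)  (inj₁ 2F) ()
  rowShift-injective (inj₁ 1F) (inj₂ k) eq =
    contradiction (sym (sucF-injective (sucF-injective eq))) (punchInᵢ≢i g′ k)
  rowShift-injective (inj₂ k) (inj₁ 1F) eq =
    contradiction (sucF-injective (sucF-injective eq)) (punchInᵢ≢i g′ k)
  rowShift-injective (inj₂ k) (inj₂ l) eq =
    cong inj₂ (punchIn-injective g′ k l (sucF-injective (sucF-injective eq)))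

  -- The values on inj₁ are 0, h - 1, h + 1, which are rowShift - difference modulo n = 2 h.
  colShift : Slot → Fin n
  colShift (inj₁ 0F) = 0F
  colShift (inj₁ 1F) = suc g″
  colShift (inj₁ 2F) = suc (punchIn g″ 1+g″)
  colShift (inj₂ k)  = suc (punchIn g″ (punchIn 1+g″ k))

  colShift-injective : ∀ r s → colShift r ≡ colShift s → r ≡ s
  colShift-injective (inj₁ 0F) (inj₁ 0F) eq = refl
  colShift-injective (inj₁ 1F) (inj₁ 1F) eq = refl
  colShift-injective (inj₁ 2F) (inj₁ 2F) eq = refl
  colShift-injective (inj₁ 0F) (inj₁ 1F) ()
  colShift-injective (inj₁ 0F) (inj₁ 2F) ()
  colShift-injective (inj₁ 1F) (inj₁ 0F) ()
  colShift-injective (inj₁ 2F) (inj₁ 0F) ()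
  colShift-injective (inj₁ 0F) (inj₂ k)  ()
  colShift-injective (inj₂ k)  (inj₁ 0F) ()
  colShift-injective (inj₁ 1F) (inj₁ 2F) eq = contradiction (sym (sucF-injective eq)) (punchInᵢ≢i g″ _)
  colShift-injective (inj₁ 2F) (inj₁ 1F) eq = contradiction (sucF-injective eq) (punchInᵢ≢i g″ _)
  colShift-injective (inj₁ 1F) (inj₂ k)  eq = contradiction (sym (sucF-injective eq)) (punchInᵢ≢i g″ _)
  colShift-injective (inj₂ k)  (inj₁ 1F) eq = contradiction (sucF-injective eq) (punchInᵢ≢i g″ _)
  colShift-injective (inj₁ 2F) (inj₂ k)  eq =
    contradiction (sym (punchIn-injective g″ _ _ (sucF-injective eq))) (punchInᵢ≢i 1+g″ k)
  colShift-injective (inj₂ k)  (inj₁ 2F) eq =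
    contradiction (punchIn-injective g″ _ _ (sucF-injective eq)) (punchInᵢ≢i 1+g″ k)
  colShift-injective (inj₂ k)  (inj₂ l)  eq =
    cong inj₂ (punchIn-injective 1+g″ k l (punchIn-injective g″ _ _ (sucF-injective eq)))

  row-col-shift : ∀ i → ⟦ rowShift (inj₁ i) ⟧ -ℤ ⟦ difference (inj₁ i) ⟧ ≋ ⟦ colShift (inj₁ i) ⟧
  row-col-shift 0F = divides (+ 0) refl
  row-col-shift 1F = divides (+ 0) (begin
    (⟦ h′ ⟧ -ℤ + 1) -ℤ + suc (toℕ g″) ≡⟨ cong₂ (λ p q → (+ p -ℤ + 1) -ℤ + suc q) toℕ-h′ toℕ-g″ ⟩
    (+ 2 +ℤ + g -ℤ + 1) -ℤ (+ 1 +ℤ + g)      ≡⟨ lemma (+ g) ⟩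
    + 0 *ℤ + n                         ∎)
    where
    open ≡-Reasoning
    lemma : ∀ g → (+ 2 +ℤ g -ℤ + 1) -ℤ (+ 1 +ℤ g) ≡ + 0
    lemma = solve-∀ℤ
  -- `1 - h` and `h + 1` differ by `- 2 h`, that is, by `- n`.
  row-col-shift 2F = divides (-ℤ + 1) (begin
    (+ 1 -ℤ ⟦ h′ ⟧) -ℤ + suc (toℕ (punchIn g″ 1+g″))
      ≡⟨ cong₂ (λ p q → (+ 1 -ℤ + p) -ℤ + suc q) toℕ-h′
           (trans (toℕ-punchIn-≤ g″ 1+g″ g″≤1+g″) (cong suc toℕ-1+g″)) ⟩
    (+ 1 -ℤ (+ 2 +ℤ + g)) -ℤ (+ 3 +ℤ + g) ≡⟨ lemma (+ g) ⟩
    -ℤ + 1 *ℤ (+ 4 +ℤ (+ g +ℤ + g))       ≡⟨⟩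
    -ℤ + 1 *ℤ + n                         ∎)
    where
    open ≡-Reasoning
    lemma : ∀ g → (+ 1 -ℤ (+ 2 +ℤ g)) -ℤ (+ 3 +ℤ g) ≡ -ℤ + 1 *ℤ (+ 4 +ℤ (g +ℤ g))
    lemma = solve-∀ℤ
    g″≤1+g″ : toℕ g″ ≤ toℕ 1+g″
    g″≤1+g″ = subst₂ _≤_ (sym toℕ-g″) (sym toℕ-1+g″) (ℕ.n≤1+n g)

  -- A line outside the subsquare, seen from its own label `z`: cells shared with other such lines
  -- are indexed by slot, those in the strip beside the subsquare by `inj₂`. Rows and columns both
  -- have this form, so one injectivity proof serves both.
  arrange : (Slot → Fin n) → Fin n → Slot ⊎ Fin t → Symbol
  arrange shift z (inj₁ (inj₁ i)) = inj₁ (z ⊕ shift (inj₁ i))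
  arrange shift z (inj₁ (inj₂ k)) = inj₂ k
  arrange shift z (inj₂ q)        = inj₁ (z ⊕ shift (inj₂ q))

  arrange-injective : ∀ {shift} → (∀ r s → shift r ≡ shift s → r ≡ s) →
    ∀ z r s → arrange shift z r ≡ arrange shift z s → r ≡ s
  arrange-injective inj z (inj₁ (inj₁ i)) (inj₁ (inj₁ j)) eq =
    cong inj₁ (inj _ _ (⊕-cancelˡ z (inj₁-injective eq)))
  arrange-injective inj z (inj₁ (inj₂ k)) (inj₁ (inj₂ l)) eq = cong (inj₁ ∘ inj₂) (inj₂-injective eq)
  arrange-injective inj z (inj₁ (inj₁ i)) (inj₂ q)        eq
    with () ← inj _ _ (⊕-cancelˡ z (inj₁-injective eq))
  arrange-injective inj z (inj₂ q)        (inj₁ (inj₁ i)) eq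
    with () ← inj _ _ (⊕-cancelˡ z (inj₁-injective eq))
  arrange-injective inj z (inj₂ p)        (inj₂ q)        eq =
    cong inj₂ (inj₂-injective (inj _ _ (⊕-cancelˡ z (inj₁-injective eq))))

  -- In the strips each outer line receives the fillers that its three filler cells leave over.
  -- Along a line through the subsquare these are translates of the label by a constant, hence
  -- distinct.
  latin : Symbol → Symbol → Symbol
  latin (inj₁ x) (inj₁ y) = arrange rowShift x (inj₁ (slot (y ⊝ x)))
  latin (inj₁ x) (inj₂ q) = arrange rowShift x (inj₂ q)
  latin (inj₂ p) (inj₁ y) = arrange colShift y (inj₂ p)
  latin (inj₂ p) (inj₂ q) = inj₂ (T.red (+ 2 *ℤ T.⟦ p ⟧ +ℤ T.⟦ q ⟧))

  -- The definition reads a cell from its row; by `row-col-shift` the same cell read from its column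
  -- is an arrangement with `colShift`. A colour depends on the slot alone.
  latin-col : ∀ x y → latin (inj₁ x) (inj₁ y) ≡ arrange colShift y (inj₁ (slot (y ⊝ x)))
  latin-col x y with slot (y ⊝ x) | difference-slot (y ⊝ x)
  ... | inj₁ i | eq = cong inj₁ (⊕-shift x y (sym eq) (row-col-shift i))
  ... | inj₂ k | eq = refl

  latin-row-injective : ∀ X {Y Z} → latin X Y ≡ latin X Z → Y ≡ Z
  latin-row-injective (inj₁ x) {inj₁ y} {inj₁ z} eq =
    cong inj₁ (⊝-cancelʳ x (slot-injective (inj₁-injective (arrange-injective rowShift-injective x _ _ eq))))
  latin-row-injective (inj₁ x) {inj₁ y} {inj₂ q} eq with () ← arrange-injective rowShift-injective x (inj₁ _) (inj₂ _) eq
  latin-row-injective (inj₁ x) {inj₂ p} {inj₁ z} eq with () ← arrange-injective rowShift-injective x (inj₂ _) (inj₁ _) eq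
  latin-row-injective (inj₁ x) {inj₂ p} {inj₂ q} eq =
    cong inj₂ (inj₂-injective (arrange-injective rowShift-injective x _ _ eq))
  latin-row-injective (inj₂ p) {inj₁ y} {inj₁ z} eq = cong inj₁ (⊕-cancelʳ (colShift (inj₂ p)) (inj₁-injective eq))
  latin-row-injective (inj₂ p) {inj₂ q} {inj₂ r} eq =
    cong inj₂ (T.≋⇒≡ (subst (+ t ∣ℤ_) (lemma T.⟦ p ⟧ T.⟦ q ⟧ T.⟦ r ⟧) (T.red-injective (inj₂-injective eq))))
    where
    lemma : ∀ p q r → (+ 2 *ℤ p +ℤ q) -ℤ (+ 2 *ℤ p +ℤ r) ≡ q -ℤ r
    lemma = solve-∀ℤ

  latin-col-injective : ∀ Y {X Z} → latin X Y ≡ latin Z Y → X ≡ Z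
  latin-col-injective (inj₁ y) {inj₁ x} {inj₁ z} eq =
    cong inj₁ (⊝-cancelˡ y (slot-injective (inj₁-injective (arrange-injective colShift-injective y _ _
      (trans (sym (latin-col x y)) (trans eq (latin-col z y)))))))
  latin-col-injective (inj₁ y) {inj₁ x} {inj₂ q} eq
    with () ← arrange-injective colShift-injective y (inj₁ _) (inj₂ _) (trans (sym (latin-col x y)) eq)
  latin-col-injective (inj₁ y) {inj₂ p} {inj₁ z} eq
    with () ← arrange-injective colShift-injective y (inj₂ _) (inj₁ _) (trans eq (latin-col z y))
  latin-col-injective (inj₁ y) {inj₂ p} {inj₂ q} eq =
    cong inj₂ (inj₂-injective (arrange-injective colShift-injective y _ _ eq))
  latin-col-injective (inj₂ q) {inj₁ x} {inj₁ z} eq = cong inj₁ (⊕-cancelʳ (rowShift (inj₂ q)) (inj₁-injective eq))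
  -- `1 + g` is the inverse of 2 modulo `t = 2 g + 1`.
  latin-col-injective (inj₂ q) {inj₂ p} {inj₂ r} eq =
    cong inj₂ (T.≋⇒≡ (subst (+ t ∣ℤ_) (lemma (+ g) T.⟦ p ⟧ T.⟦ q ⟧ T.⟦ r ⟧)
      (∣m∣n⇒∣m-n (∣n⇒∣m*n (+ 1 +ℤ + g) (T.red-injective (inj₂-injective eq)))
                 (∣m⇒∣m*n (T.⟦ p ⟧ -ℤ T.⟦ r ⟧) (∣-refl {+ t})))))
    where
    lemma : ∀ g p q r → (+ 1 +ℤ g) *ℤ ((+ 2 *ℤ p +ℤ q) -ℤ (+ 2 *ℤ r +ℤ q))
                          -ℤ (+ 1 +ℤ (g +ℤ g)) *ℤ (p -ℤ r) ≡ p -ℤ r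
    lemma = solve-∀ℤ

  -- Difference 0 has shift 0 outside the subsquare; inside, `2 p + q` becomes `3 p`.
  diagonal : Symbol → Symbol
  diagonal (inj₁ x) = inj₁ (x ⊕ 0F)
  diagonal (inj₂ p) = inj₂ (T.red (+ 2 *ℤ T.⟦ p ⟧ +ℤ T.⟦ p ⟧))

  latin-diagonal : ∀ X → latin X X ≡ diagonal X
  latin-diagonal (inj₁ x) = cong (arrange rowShift x ∘ inj₁ ∘ slot) (⊝-≡ x x 0F (divides (+ 0) (lemma ⟦ x ⟧)))
    where
    lemma : ∀ x → x -ℤ x -ℤ + 0 ≡ + 0
    lemma = solve-∀ℤ
  latin-diagonal (inj₂ p) = refl

  diagonal-injective : ∀ {X Y} → diagonal X ≡ diagonal Y → X ≡ Y
  diagonal-injective {inj₁ x} {inj₁ y} eq = cong inj₁ (⊕-cancelʳ 0F (inj₁-injective eq))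
  -- By `bézout`, multiplication by `α` undoes the factor 3 modulo `t`.
  diagonal-injective {inj₂ p} {inj₂ r} eq =
    cong inj₂ (T.≋⇒≡ (subst (+ t ∣ℤ_) combination
      (∣m∣n⇒∣m+n (∣m⇒∣m*n α (T.red-injective (inj₂-injective eq)))
                 (∣m⇒∣m*n (β *ℤ (T.⟦ p ⟧ -ℤ T.⟦ r ⟧)) (∣-refl {+ t})))))
    where
    lemma : ∀ t p r α β → ((+ 2 *ℤ p +ℤ p) -ℤ (+ 2 *ℤ r +ℤ r)) *ℤ α +ℤ t *ℤ (β *ℤ (p -ℤ r))
                            ≡ (+ 3 *ℤ α +ℤ t *ℤ β) *ℤ (p -ℤ r)
    lemma = solve-∀ℤ
    combination : ((+ 2 *ℤ T.⟦ p ⟧ +ℤ T.⟦ p ⟧) -ℤ (+ 2 *ℤ T.⟦ r ⟧ +ℤ T.⟦ r ⟧)) *ℤ α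
                    +ℤ + t *ℤ (β *ℤ (T.⟦ p ⟧ -ℤ T.⟦ r ⟧)) ≡ T.⟦ p ⟧ -ℤ T.⟦ r ⟧
    combination = trans (lemma (+ t) T.⟦ p ⟧ T.⟦ r ⟧ α β)
      (trans (cong (_*ℤ (T.⟦ p ⟧ -ℤ T.⟦ r ⟧)) bézout) (ℤ.*-identityˡ _))

  -- The label pairs met on the antidiagonal, kept as a relation so that the Latin property is
  -- independent of the numbering of the rows.
  data Opposed : Symbol → Symbol → Set where
    half-turn : ∀ {x y} → y ⊝ x ≡ h′ → Opposed (inj₁ x) (inj₁ y)
    mirror    : ∀ p → Opposed (inj₂ p) (inj₂ (opposite p))

  antidiagonal : Symbol → Symbol
  antidiagonal (inj₁ x) = inj₁ (x ⊕ 1F)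
  antidiagonal (inj₂ p) = inj₂ (T.red (T.⟦ p ⟧ -ℤ + 1))

  latin-antidiagonal : ∀ {X Y} → Opposed X Y → latin X Y ≡ antidiagonal X
  latin-antidiagonal (half-turn {x} y⊝x≡h) =
    cong (arrange rowShift x ∘ inj₁) (trans (cong slot y⊝x≡h) slot-h′)
  -- `opposite p` is `t - 1 - p`, so `2 p + q` is `p - 1 + t`.
  latin-antidiagonal (mirror p) = cong inj₂ (T.red-cong (divides (+ 1)
    (trans (lemma T.⟦ p ⟧ T.⟦ opposite p ⟧)
           (cong (λ m → + 1 *ℤ + m) (opposite-+ p)))))
    where
    lemma : ∀ p q → (+ 2 *ℤ p +ℤ q) -ℤ (p -ℤ + 1) ≡ + 1 *ℤ (q +ℤ (+ 1 +ℤ p))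
    lemma = solve-∀ℤ

  antidiagonal-injective : ∀ {X Y} → antidiagonal X ≡ antidiagonal Y → X ≡ Y
  antidiagonal-injective {inj₁ x} {inj₁ y} eq = cong inj₁ (⊕-cancelʳ 1F (inj₁-injective eq))
  antidiagonal-injective {inj₂ p} {inj₂ r} eq =
    cong inj₂ (T.≋⇒≡ (subst (+ t ∣ℤ_) (lemma T.⟦ p ⟧ T.⟦ r ⟧) (T.red-injective (inj₂-injective eq))))
    where
    lemma : ∀ p r → (p -ℤ + 1) -ℤ (r -ℤ + 1) ≡ p -ℤ r
    lemma = solve-∀ℤ

  -- Numbering of rows and columns.

  Position : Set
  Position = Fin h ⊎ (Fin t ⊎ Fin h)

  position : Fin N → Position
  position i = Sum.map₂ (splitAt t) (splitAt h i)

  index : Position → Fin N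
  index (inj₁ i)        = i ↑ˡ (t + h)
  index (inj₂ (inj₁ q)) = h ↑ʳ (q ↑ˡ h)
  index (inj₂ (inj₂ j)) = h ↑ʳ (t ↑ʳ j)

  position-index : ∀ s → position (index s) ≡ s
  position-index (inj₁ i)        rewrite splitAt-↑ˡ h i (t + h) = refl
  position-index (inj₂ (inj₁ q)) rewrite splitAt-↑ʳ h (t + h) (q ↑ˡ h) | splitAt-↑ˡ t q h = refl
  position-index (inj₂ (inj₂ j)) rewrite splitAt-↑ʳ h (t + h) (t ↑ʳ j) | splitAt-↑ʳ t h j = refl

  index-position : ∀ i → index (position i) ≡ i
  index-position i with splitAt h i in eq
  ... | inj₁ k = splitAt⁻¹-↑ˡ eq
  ... | inj₂ k with splitAt t k in eq′
  ...   | inj₁ q = trans (cong (h ↑ʳ_) (splitAt⁻¹-↑ˡ eq′)) (splitAt⁻¹-↑ʳ eq)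
  ...   | inj₂ j = trans (cong (h ↑ʳ_) (splitAt⁻¹-↑ʳ eq′)) (splitAt⁻¹-↑ʳ eq)

  reflect : Position → Position
  reflect (inj₁ i)        = inj₂ (inj₂ (opposite i))
  reflect (inj₂ (inj₁ q)) = inj₂ (inj₁ (opposite q))
  reflect (inj₂ (inj₂ j)) = inj₁ (opposite j)

  complement : ∀ {m} {a b : Fin m} → toℕ b + suc (toℕ a) ≡ m → opposite a ≡ b
  complement {m} {a} {b} eq = toℕ-injective
    (ℕ.+-cancelʳ-≡ (suc (toℕ a)) _ _ (trans (opposite-+ a) (sym eq)))

  -- The outer blocks have equal length `h`, so reflection exchanges them and keeps the middle one;
  -- thus the diagonals of the subsquare lie on those of the square.
  opposite-index : ∀ s → opposite (index s) ≡ index (reflect s)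
  opposite-index (inj₁ i) = complement (begin
    toℕ (h ↑ʳ (t ↑ʳ opposite i)) + suc (toℕ (i ↑ˡ (t + h)))
      ≡⟨ cong₂ (λ a b → a + suc b) (trans (toℕ-↑ʳ h _) (cong (λ m → h + m) (toℕ-↑ʳ t _))) (toℕ-↑ˡ i _) ⟩
    h + (t + toℕ (opposite i)) + suc (toℕ i)
      ≡⟨ lemma h t (toℕ (opposite i)) (suc (toℕ i)) ⟩
    h + (t + (toℕ (opposite i) + suc (toℕ i)))
      ≡⟨ cong (λ a → h + (t + a)) (opposite-+ i) ⟩
    N ∎)
    where
    open ≡-Reasoning
    lemma : ∀ h t a b → h + (t + a) + b ≡ h + (t + (a + b))
    lemma = solve-∀ℕ
  opposite-index (inj₂ (inj₁ q)) = complement (begin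
    toℕ (h ↑ʳ (opposite q ↑ˡ h)) + suc (toℕ (h ↑ʳ (q ↑ˡ h)))
      ≡⟨ cong₂ (λ a b → a + suc b) (trans (toℕ-↑ʳ h _) (cong (λ m → h + m) (toℕ-↑ˡ (opposite q) h)))
                                   (trans (toℕ-↑ʳ h _) (cong (λ m → h + m) (toℕ-↑ˡ q h))) ⟩
    h + toℕ (opposite q) + suc (h + toℕ q)
      ≡⟨ lemma h (toℕ (opposite q)) (toℕ q) ⟩
    h + (toℕ (opposite q) + suc (toℕ q) + h)
      ≡⟨ cong (λ a → h + (a + h)) (opposite-+ q) ⟩
    N ∎)
    where
    open ≡-Reasoning
    lemma : ∀ h a b → h + a + suc (h + b) ≡ h + (a + suc b + h)
    lemma = solve-∀ℕ
  opposite-index (inj₂ (inj₂ j)) = complement (begin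
    toℕ (opposite j ↑ˡ (t + h)) + suc (toℕ (h ↑ʳ (t ↑ʳ j)))
      ≡⟨ cong₂ (λ a b → a + suc b) (toℕ-↑ˡ (opposite j) _) (trans (toℕ-↑ʳ h _) (cong (λ m → h + m) (toℕ-↑ʳ t _))) ⟩
    toℕ (opposite j) + suc (h + (t + toℕ j))
      ≡⟨ lemma h t (toℕ (opposite j)) (toℕ j) ⟩
    h + (t + (toℕ (opposite j) + suc (toℕ j)))
      ≡⟨ cong (λ a → h + (t + a)) (opposite-+ j) ⟩
    N ∎)
    where
    open ≡-Reasoning
    lemma : ∀ h t a b → a + suc (h + (t + b)) ≡ h + (t + (a + suc b))
    lemma = solve-∀ℕ

  h+h≡n : h + h ≡ n
  h+h≡n = lemma g
    where
    lemma : ∀ g → 2 + g + (2 + g) ≡ 4 + (g + g)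
    lemma = solve-∀ℕ

  low<n : ∀ (i : Fin h) → toℕ i < n
  low<n i = ℕ.<-≤-trans (toℕ<n i) (subst (h ≤_) h+h≡n (ℕ.m≤m+n h h))

  high<n : ∀ (i : Fin h) → h + toℕ i < n
  high<n i = subst (h + toℕ i <_) h+h≡n (ℕ.+-monoʳ-< h (toℕ<n i))

  low high : Fin h → Fin n
  low  i = fromℕ< (low<n i)
  high i = fromℕ< (high<n i)

  toℕ-low : ∀ i → toℕ (low i) ≡ toℕ i
  toℕ-low i = toℕ-fromℕ< (low<n i)

  toℕ-high : ∀ i → toℕ (high i) ≡ h + toℕ i
  toℕ-high i = toℕ-fromℕ< (high<n i)

  low≢high : ∀ i j → low i ≢ high j
  low≢high i j eq = ℕ.<⇒≢ (ℕ.<-≤-trans (toℕ<n i) (ℕ.m≤m+n h (toℕ j)))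
    (trans (sym (toℕ-low i)) (trans (cong toℕ eq) (toℕ-high j)))

  high⊝low : ∀ i → high i ⊝ low i ≡ h′
  high⊝low i = ⊝-≡ (low i) (high i) h′ (divides (+ 0) (begin
    + toℕ (high i) -ℤ + toℕ (low i) -ℤ + toℕ h′
      ≡⟨ cong₂ (λ a b → a -ℤ b -ℤ + toℕ h′) (cong +_ (toℕ-high i)) (cong +_ (toℕ-low i)) ⟩
    + h +ℤ + toℕ i -ℤ + toℕ i -ℤ + toℕ h′
      ≡⟨ cong (λ a → + h +ℤ + toℕ i -ℤ + toℕ i -ℤ + a) toℕ-h′ ⟩
    + h +ℤ + toℕ i -ℤ + toℕ i -ℤ + h
      ≡⟨ lemma (+ h) (+ toℕ i) ⟩
    + 0 ∎))
    where
    open ≡-Reasoning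
    lemma : ∀ h i → h +ℤ i -ℤ i -ℤ h ≡ + 0
    lemma = solve-∀ℤ

  -- `- h` is `h` modulo `n = 2 h`, so both halves of the antidiagonal show the same difference.
  low⊝high : ∀ i → low i ⊝ high i ≡ h′
  low⊝high i = ⊝-≡ (high i) (low i) h′ (divides (-ℤ + 1) (begin
    + toℕ (low i) -ℤ + toℕ (high i) -ℤ + toℕ h′
      ≡⟨ cong₂ (λ a b → a -ℤ b -ℤ + toℕ h′) (cong +_ (toℕ-low i)) (cong +_ (toℕ-high i)) ⟩
    + toℕ i -ℤ (+ h +ℤ + toℕ i) -ℤ + toℕ h′
      ≡⟨ cong (λ a → + toℕ i -ℤ (+ h +ℤ + toℕ i) -ℤ + a) toℕ-h′ ⟩
    + toℕ i -ℤ (+ h +ℤ + toℕ i) -ℤ + h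
      ≡⟨ lemma (+ h) (+ toℕ i) ⟩
    -ℤ + 1 *ℤ (+ h +ℤ + h)
      ≡⟨ cong (λ m → -ℤ + 1 *ℤ + m) h+h≡n ⟩
    -ℤ + 1 *ℤ + n ∎))
    where
    open ≡-Reasoning
    lemma : ∀ h i → i -ℤ (h +ℤ i) -ℤ h ≡ -ℤ + 1 *ℤ (h +ℤ h)
    lemma = solve-∀ℤ

  -- The last block is numbered backwards, so that reflection is the half turn x ↦ x + h.
  symbolOf : Position → Symbol
  symbolOf (inj₁ i)        = inj₁ (low i)
  symbolOf (inj₂ (inj₁ q)) = inj₂ q
  symbolOf (inj₂ (inj₂ j)) = inj₁ (high (opposite j))

  symbolOf-injective : ∀ r s → symbolOf r ≡ symbolOf s → r ≡ s
  symbolOf-injective (inj₁ i) (inj₁ j) eq = cong inj₁ (toℕ-injective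
    (trans (sym (toℕ-low i)) (trans (cong toℕ (inj₁-injective eq)) (toℕ-low j))))
  symbolOf-injective (inj₁ i) (inj₂ (inj₂ j)) eq = contradiction (inj₁-injective eq) (low≢high _ _)
  symbolOf-injective (inj₂ (inj₂ j)) (inj₁ i) eq = contradiction (sym (inj₁-injective eq)) (low≢high _ _)
  symbolOf-injective (inj₂ (inj₁ q)) (inj₂ (inj₁ p)) eq = cong (inj₂ ∘ inj₁) (inj₂-injective eq)
  symbolOf-injective (inj₂ (inj₂ i)) (inj₂ (inj₂ j)) eq = cong (inj₂ ∘ inj₂) (begin
    i                     ≡⟨ opposite-involutive i ⟨
    opposite (opposite i) ≡⟨ cong opposite (toℕ-injective (ℕ.+-cancelˡ-≡ h _ _
                               (trans (sym (toℕ-high _)) (trans (cong toℕ (inj₁-injective eq)) (toℕ-high _))))) ⟩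
    opposite (opposite j) ≡⟨ opposite-involutive j ⟩
    j                     ∎)
    where open ≡-Reasoning

  symbolOf-reflect : ∀ s → Opposed (symbolOf s) (symbolOf (reflect s))
  symbolOf-reflect (inj₁ i) =
    half-turn (subst (λ k → high k ⊝ low i ≡ h′) (sym (opposite-involutive i)) (high⊝low i))
  symbolOf-reflect (inj₂ (inj₁ q)) = mirror q
  symbolOf-reflect (inj₂ (inj₂ j)) = half-turn (low⊝high (opposite j))

  symbolAt : Fin N → Symbol
  symbolAt i = symbolOf (position i)

  symbolAt-injective : ∀ {i j} → symbolAt i ≡ symbolAt j → i ≡ j
  symbolAt-injective {i} {j} eq = trans (sym (index-position i))
    (trans (cong index (symbolOf-injective _ _ eq)) (index-position j))

  symbolAt-opposite : ∀ i → Opposed (symbolAt i) (symbolAt (opposite i))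
  symbolAt-opposite i = subst (λ s → Opposed (symbolAt i) (symbolOf s)) (sym (begin
    position (opposite i)                    ≡⟨ cong (position ∘ opposite) (index-position i) ⟨
    position (opposite (index (position i))) ≡⟨ cong position (opposite-index (position i)) ⟩
    position (index (reflect (position i)))  ≡⟨ position-index _ ⟩
    reflect (position i)                     ∎)) (symbolOf-reflect (position i))
    where open ≡-Reasoning

-- Sums along injective families.

sumFin-cong : ∀ {m} {f g : Fin m → ℤ} → (∀ i → f i ≡ g i) → sumFin f ≡ sumFin g
sumFin-cong {zero}  f≗g = refl
sumFin-cong {suc m} f≗g = cong₂ _+ℤ_ (f≗g zero) (sumFin-cong (f≗g ∘ suc))

sumFin-punchIn : ∀ {m} (f : Fin (suc m) → ℤ) i → f i +ℤ sumFin (f ∘ punchIn i) ≡ sumFin f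
sumFin-punchIn f i = begin
  f i +ℤ sumFin (f ∘ punchIn i) ≡⟨ cong (f i +ℤ_) (sumFin≡sum (f ∘ punchIn i)) ⟩
  f i +ℤ sumℤ (f ∘ punchIn i)   ≡⟨ sum-remove f ⟨
  sumℤ f                        ≡⟨ sumFin≡sum f ⟨
  sumFin f                      ∎
  where
  open ≡-Reasoning
  open CommutativeMonoidSum ℤ.+-0-commutativeMonoid using (sum-remove) renaming (sum to sumℤ)
  sumFin≡sum : ∀ {m} (f : Fin m → ℤ) → sumFin f ≡ sumℤ f
  sumFin≡sum {zero}  f = refl
  sumFin≡sum {suc m} f = cong (f zero +ℤ_) (sumFin≡sum (f ∘ suc))

-- An injective self-map of a finite set permutes it. The induction takes the value `f zero` out and
-- closes the gap with `punchOut`.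
sumFin-rearrange : ∀ {m} (w : Fin m → ℤ) (f : Fin m → Fin m) → (∀ {i j} → f i ≡ f j → i ≡ j) →
                   sumFin (w ∘ f) ≡ sumFin w
sumFin-rearrange {zero}  w f inj = refl
sumFin-rearrange {suc m} w f inj = begin
  w (f zero) +ℤ sumFin (w ∘ f ∘ suc)
    ≡⟨ cong (w (f zero) +ℤ_) (sumFin-cong λ i → cong w (sym (punchIn-punchOut (f0≢ i)))) ⟩
  w (f zero) +ℤ sumFin (w ∘ punchIn (f zero) ∘ f′)
    ≡⟨ cong (w (f zero) +ℤ_) (sumFin-rearrange (w ∘ punchIn (f zero)) f′ f′-injective) ⟩
  w (f zero) +ℤ sumFin (w ∘ punchIn (f zero))
    ≡⟨ sumFin-punchIn w (f zero) ⟩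
  sumFin w ∎
  where
  open ≡-Reasoning
  f0≢ : ∀ i → f zero ≢ f (suc i)
  f0≢ i eq with () ← inj eq
  f′ : Fin m → Fin m
  f′ i = punchOut (f0≢ i)
  f′-injective : ∀ {i j} → f′ i ≡ f′ j → i ≡ j
  f′-injective {i} {j} eq = sucF-injective (inj (punchOut-injective (f0≢ i) (f0≢ j) eq))

sumFin-splitAt : ∀ m {n} (w : Fin m ⊎ Fin n → ℤ) →
                 sumFin (w ∘ splitAt m) ≡ sumFin (w ∘ inj₁) +ℤ sumFin (w ∘ inj₂)
sumFin-splitAt zero    w = sym (ℤ.+-identityˡ _)
sumFin-splitAt (suc m) w = trans
  (cong (w (inj₁ zero) +ℤ_) (sumFin-splitAt m (w ∘ Sum.map₁ suc)))
  (sym (ℤ.+-assoc (w (inj₁ zero)) _ _))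

-- By counting, `f` is a bijection. This evaluates every line of the square, with fillers and
-- colours as the two summands.
sumFin-⊎ : ∀ {l m n} → l ≡ m + n → (w : Fin m ⊎ Fin n → ℤ) (f : Fin l → Fin m ⊎ Fin n) →
           (∀ {i j} → f i ≡ f j → i ≡ j) →
           sumFin (w ∘ f) ≡ sumFin (w ∘ inj₁) +ℤ sumFin (w ∘ inj₂)
sumFin-⊎ {m = m} {n} refl w f inj = begin
  sumFin (w ∘ f)                           ≡⟨ sumFin-cong (λ i → cong w (sym (splitAt-join m n (f i)))) ⟩
  sumFin (w ∘ splitAt m ∘ join m n ∘ f)    ≡⟨ sumFin-rearrange (w ∘ splitAt m) (join m n ∘ f) joined ⟩
  sumFin (w ∘ splitAt m)                   ≡⟨ sumFin-splitAt m w ⟩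
  sumFin (w ∘ inj₁) +ℤ sumFin (w ∘ inj₂)   ∎
  where
  open ≡-Reasoning
  joined : ∀ {i j} → join m n (f i) ≡ join m n (f j) → i ≡ j
  joined {i} {j} eq = inj (trans (sym (splitAt-join m n (f i)))
    (trans (cong (splitAt m) eq) (splitAt-join m n (f j))))

pos-^ : ∀ m k → (+ m) ^ℤ k ≡ + (m ^ k)
pos-^ m zero    = refl
pos-^ m (suc k) = trans (cong (+ m *ℤ_) (pos-^ m k)) (sym (ℤ.pos-* m (m ^ k)))

sumFin-pos : ∀ {m} (f : Fin m → ℕ) → sumFin (λ i → + f i) ≡ + sumℕ f
sumFin-pos {zero}  f = refl
sumFin-pos {suc m} f = cong (+ f zero +ℤ_) (sumFin-pos (f ∘ suc))

-- The multimagic square.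

module Multimagic
  (g : ℕ) (α β : ℤ) (bézout : + 3 *ℤ α +ℤ + suc (g + g) *ℤ β ≡ + 1) (K M : ℕ)
  (a b : Fin (suc (g + g)) → ℕ) (a<M : ∀ i → a i < M) (b<M : ∀ i → b i < M)
  (a-injective : ∀ i j → a i ≡ a j → i ≡ j)
  (powerSums≡ : ∀ k → 1 ≤ k → k ≤ K → sumℕ (λ i → a i ^ k) ≡ sumℕ (λ i → b i ^ k))
  (c : Fin (suc (g + g))) (new : ∀ i → a i ≢ b c)
  where

  open Square g α β bézout

  -- Fillers start at `M`, above every entry of `a` and `b`, so they never collide with colours.
  value : (Fin t → ℕ) → Symbol → ℤ
  value d (inj₁ f) = + (M + toℕ f)
  value d (inj₂ k) = + d k

  coloursOf : Symbol → Fin t → ℕ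
  coloursOf (inj₁ _) = a
  coloursOf (inj₂ _) = b

  entry : Symbol → Symbol → ℤ
  entry X Y = value (coloursOf X) (latin X Y)

  square : Matrix N
  square i j = entry (symbolAt i) (symbolAt j)

  -- Cells in the strips hold fillers, on which the tuple has no influence; hence row and column may
  -- equally decide between `a` and `b`.
  entry-col : ∀ X Y → entry X Y ≡ value (coloursOf Y) (latin X Y)
  entry-col (inj₁ _) (inj₁ _) = refl
  entry-col (inj₁ _) (inj₂ _) = refl
  entry-col (inj₂ _) (inj₁ _) = refl
  entry-col (inj₂ _) (inj₂ _) = refl

  -- Outside the subsquare the diagonal meets only fillers, so `b` can be taken along all of it.
  entry-diagonal : ∀ X → entry X X ≡ value b (diagonal X)
  entry-diagonal (inj₁ x) rewrite latin-diagonal (inj₁ x) = refl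
  entry-diagonal (inj₂ p) = refl

  entry-antidiagonal : ∀ {X Y} → Opposed X Y → entry X Y ≡ value b (antidiagonal X)
  entry-antidiagonal opp@(half-turn _) rewrite latin-antidiagonal opp = refl
  entry-antidiagonal opp@(mirror _)    = cong (value b) (latin-antidiagonal opp)

  N≡n+t : N ≡ n + t
  N≡n+t = lemma g
    where
    lemma : ∀ g → 2 + g + (1 + (g + g) + (2 + g)) ≡ 4 + (g + g) + (1 + (g + g))
    lemma = solve-∀ℕ

  total : ℕ → (Fin t → ℕ) → ℤ
  total k d = sumFin (λ f → (+ (M + toℕ {n} f)) ^ℤ k) +ℤ sumFin (λ i → (+ d i) ^ℤ k)

  line-sum : ∀ k d (f : Fin N → Symbol) → (∀ {i j} → f i ≡ f j → i ≡ j) →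
             sumFin (λ i → value d (f i) ^ℤ k) ≡ total k d
  line-sum k d = sumFin-⊎ N≡n+t (λ s → value d s ^ℤ k)

  total≡ : ∀ k → 1 ≤ k → k ≤ K → total k b ≡ total k a
  total≡ k 1≤k k≤K = cong (sumFin (λ f → (+ (M + toℕ {n} f)) ^ℤ k) +ℤ_) (begin
    sumFin (λ i → (+ b i) ^ℤ k) ≡⟨ powerSum b ⟩
    + sumℕ (λ i → b i ^ k)      ≡⟨ cong +_ (powerSums≡ k 1≤k k≤K) ⟨
    + sumℕ (λ i → a i ^ k)      ≡⟨ powerSum a ⟨
    sumFin (λ i → (+ a i) ^ℤ k) ∎)
    where
    open ≡-Reasoning
    powerSum : ∀ (d : Fin t → ℕ) → sumFin (λ i → (+ d i) ^ℤ k) ≡ + sumℕ (λ i → d i ^ k)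
    powerSum d = trans (sumFin-cong (λ i → pos-^ (d i) k)) (sumFin-pos (λ i → d i ^ k))

  multimagic : IsMultimagic K N square
  multimagic k 1≤k k≤K = total k a , rows , cols , diag , anti
    where
    total-coloursOf : ∀ X → total k (coloursOf X) ≡ total k a
    total-coloursOf (inj₁ _) = refl
    total-coloursOf (inj₂ _) = total≡ k 1≤k k≤K

    line : ∀ d (f : Fin N → Symbol) → (∀ {i j} → f i ≡ f j → i ≡ j) → total k d ≡ total k a →
           ∀ {z : Fin N → ℤ} → (∀ i → z i ≡ value d (f i)) → sumFin (λ i → z i ^ℤ k) ≡ total k a
    line d f inj tot z≗ = trans (sumFin-cong (λ i → cong (_^ℤ k) (z≗ i))) (trans (line-sum k d f inj) tot)

    rows : ∀ i → sumFin (λ j → square i j ^ℤ k) ≡ total k a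
    rows i = line (coloursOf X) (latin X ∘ symbolAt)
      (symbolAt-injective ∘ latin-row-injective X) (total-coloursOf X) (λ _ → refl)
      where X = symbolAt i

    cols : ∀ j → sumFin (λ i → square i j ^ℤ k) ≡ total k a
    cols j = line (coloursOf Y) (λ i → latin (symbolAt i) Y)
      (symbolAt-injective ∘ latin-col-injective Y) (total-coloursOf Y) (λ i → entry-col (symbolAt i) Y)
      where Y = symbolAt j

    diag : sumFin (λ i → square i i ^ℤ k) ≡ total k a
    diag = line b (diagonal ∘ symbolAt) (symbolAt-injective ∘ diagonal-injective)
      (total≡ k 1≤k k≤K) (entry-diagonal ∘ symbolAt)

    anti : sumFin (λ i → square i (opposite i) ^ℤ k) ≡ total k a
    anti = line b (antidiagonal ∘ symbolAt) (symbolAt-injective ∘ antidiagonal-injective)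
      (total≡ k 1≤k k≤K) (entry-antidiagonal ∘ symbolAt-opposite)

  value-a-injective : ∀ {r s} → value a r ≡ value a s → r ≡ s
  value-a-injective {inj₁ f} {inj₁ e} eq =
    cong inj₁ (toℕ-injective (ℕ.+-cancelˡ-≡ M _ _ (ℤ.+-injective eq)))
  value-a-injective {inj₁ f} {inj₂ k} eq =
    contradiction (sym (ℤ.+-injective eq)) (ℕ.<⇒≢ (ℕ.<-≤-trans (a<M k) (ℕ.m≤m+n M (toℕ f))))
  value-a-injective {inj₂ k} {inj₁ f} eq =
    contradiction (ℤ.+-injective eq) (ℕ.<⇒≢ (ℕ.<-≤-trans (a<M k) (ℕ.m≤m+n M (toℕ f))))
  value-a-injective {inj₂ k} {inj₂ l} eq = cong inj₂ (a-injective k l (ℤ.+-injective eq))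

  value-a≢ : ∀ r → value a r ≢ + b c
  value-a≢ (inj₁ f) eq = ℕ.<⇒≢ (ℕ.<-≤-trans (b<M c) (ℕ.m≤m+n M (toℕ f))) (sym (ℤ.+-injective eq))
  value-a≢ (inj₂ k) eq = new k (ℤ.+-injective eq)

  nontrivial : Nontrivial N square
  nontrivial = cell , distinct
    where
    cell : Fin (suc N) → Fin N × Fin N
    -- The first row of the subsquare has colour `2 * 0 + c = c` in column `c`, hence the entry
    -- `b c`.
    cell zero    = index (inj₂ (inj₁ zero)) , index (inj₂ (inj₁ c))
    -- As `h` is positive, row `zero` lies outside the subsquare: it uses `a` and shows `N` distinct
    -- values.
    cell (suc j) = zero , j

    extra : square (index (inj₂ (inj₁ zero))) (index (inj₂ (inj₁ c))) ≡ + b c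
    extra rewrite position-index (inj₂ (inj₁ zero)) | position-index (inj₂ (inj₁ c)) =
      cong (λ k → + b k) (trans (cong T.red (ℤ.+-identityˡ T.⟦ c ⟧)) (T.red-⟦⟧ c))

    distinct : ∀ p q → ¬ p ≡ q →
      ¬ square (proj₁ (cell p)) (proj₂ (cell p)) ≡ square (proj₁ (cell q)) (proj₂ (cell q))
    distinct zero    zero    p≢q eq = p≢q refl
    distinct zero    (suc j) p≢q eq = value-a≢ _ (trans (sym eq) extra)
    distinct (suc i) zero    p≢q eq = value-a≢ _ (trans eq extra)
    distinct (suc i) (suc j) p≢q eq =
      p≢q (cong suc (symbolAt-injective (latin-row-injective (symbolAt zero) (value-a-injective eq))))

-- Choice of the parameters.

tri*2 : ∀ k → tri k * 2 ≡ k * (k + 1)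
tri*2 zero    = refl
tri*2 (suc k) = begin
  (tri k + suc k) * 2       ≡⟨ ℕ.*-distribʳ-+ 2 (tri k) (suc k) ⟩
  tri k * 2 + suc k * 2     ≡⟨ cong (_+ suc k * 2) (tri*2 k) ⟩
  k * (k + 1) + suc k * 2   ≡⟨ lemma k ⟩
  suc k * (suc k + 1)       ∎
  where
  open ≡-Reasoning
  lemma : ∀ k → k * (k + 1) + (1 + k) * 2 ≡ (1 + k) * (1 + k + 1)
  lemma = solve-∀ℕ

-- 2 tri K - 1 = K (K + 1) - 1 modulo 3 depends only on K modulo 3, and is never 0.
3-coprime : ∀ k → Σ ℤ λ α → Σ ℤ λ β → + 3 *ℤ α +ℤ (+ 2 *ℤ + tri k -ℤ + 1) *ℤ β ≡ + 1
3-coprime 0 = + 0 , -ℤ + 1 , refl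
3-coprime 1 = + 0 , + 1 , refl
3-coprime 2 = + 2 , -ℤ + 1 , refl
3-coprime (suc (suc (suc k))) with 3-coprime k
-- Three steps raise `2 * tri k - 1` by `3 * (2 k + 4)`, which the new `α` compensates.
... | α , β , eq = α -ℤ (+ 2 *ℤ + k +ℤ + 4) *ℤ β , β , trans (lemma (+ k) (+ tri k) α β) eq
  where
  lemma : ∀ k T α β →
    + 3 *ℤ (α -ℤ (+ 2 *ℤ k +ℤ + 4) *ℤ β) +ℤ (+ 2 *ℤ (T +ℤ (+ 1 +ℤ k) +ℤ (+ 2 +ℤ k) +ℤ (+ 3 +ℤ k)) -ℤ + 1) *ℤ β
      ≡ + 3 *ℤ α +ℤ (+ 2 *ℤ T -ℤ + 1) *ℤ β
  lemma = solve-∀ℤ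

-- `tri K = g + 1` gives `t = 2 g + 1 = 2 * tri K - 1`, the number that `3-coprime` treats.
nontrivialMultimagic : ∀ K g → tri K ≡ suc g → tri K < suc (g + g) →
  Σ (Matrix (2 + g + (suc (g + g) + (2 + g)))) λ z → IsMultimagic K _ z × Nontrivial _ z
nontrivialMultimagic K g tri-K tri<t = build (3-coprime K) (equalPowerSums K (suc (g + g)) tri<t)
  where
  2tri-1 : + 2 *ℤ + tri K -ℤ + 1 ≡ + suc (g + g)
  2tri-1 = trans (cong (λ m → + 2 *ℤ + m -ℤ + 1) tri-K) (lemma (+ g))
    where
    lemma : ∀ g → + 2 *ℤ (+ 1 +ℤ g) -ℤ + 1 ≡ + 1 +ℤ (g +ℤ g)
    lemma = solve-∀ℤ

  build : (Σ ℤ λ α → Σ ℤ λ β → + 3 *ℤ α +ℤ (+ 2 *ℤ + tri K -ℤ + 1) *ℤ β ≡ + 1) →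
          EqualPowerSums K (suc (g + g)) →
          Σ (Matrix (2 + g + (suc (g + g) + (2 + g)))) λ z → IsMultimagic K _ z × Nontrivial _ z
  build (α , β , bézout) (M , a , b , a<M , b<M , a-injective , powerSums≡ , c , new) =
    square , multimagic , nontrivial
    where
    open Multimagic g α β (subst (λ m → + 3 *ℤ α +ℤ m *ℤ β ≡ + 1) 2tri-1 bézout)
      K M a b a<M b<M a-injective powerSums≡ c new

-- Both sides are `4 g + 5 = 4 * tri K + 1`.
order : ∀ K g → tri K ≡ suc g → 2 + g + (suc (g + g) + (2 + g)) ≡ 2 * K * (K + 1) + 1
order K g tri-K = begin
  2 + g + (suc (g + g) + (2 + g)) ≡⟨ lemma g ⟩
  2 * (suc g * 2) + 1             ≡⟨ cong (λ m → 2 * (m * 2) + 1) tri-K ⟨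
  2 * (tri K * 2) + 1             ≡⟨ cong (λ m → 2 * m + 1) (tri*2 K) ⟩
  2 * (K * (K + 1)) + 1           ≡⟨ cong (_+ 1) (ℕ.*-assoc 2 K (K + 1)) ⟨
  2 * K * (K + 1) + 1             ∎
  where
  open ≡-Reasoning
  lemma : ∀ g → 2 + g + (1 + (g + g) + (2 + g)) ≡ 2 * ((1 + g) * 2) + 1
  lemma = solve-∀ℕ

theorem1 : (K : ℕ) → 2 ≤ K →
    Σ (Matrix (2 * K * (K + 1) + 1)) λ z →
      IsMultimagic K (2 * K * (K + 1) + 1) z × Nontrivial (2 * K * (K + 1) + 1) z
theorem1 K@(suc k) (s≤s 1≤k) =
  subst (λ m → Σ (Matrix m) λ z → IsMultimagic K m z × Nontrivial m z) (order K g tri-K)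
    (nontrivialMultimagic K g tri-K tri<t)
  where
  g : ℕ
  g = tri k + k

  tri-K : tri K ≡ suc g
  tri-K = ℕ.+-suc (tri k) k

  tri<t : tri K < suc (g + g)
  -- `K` being at least 2 enters here: `1 ≤ k` gives `1 ≤ g`, so `g + 1 ≤ g + g`.
  tri<t = s≤s (subst (_≤ g + g) (sym tri-K) (ℕ.+-monoˡ-≤ g (ℕ.≤-trans 1≤k (ℕ.m≤n+m k (tri k)))))
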